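{- Let $G$ be a graph and $u\in V(G)$. Let $H$ be the graph obtained from $G$ by attaching a false twin $u'$ to $u$, i.e. by adding a new vertex $u'$ whose neighbors are exactly the vertices of $N_G(u)$. Then $\gamma_I(H)=\gamma_I(G)$ or $\gamma_I(H)=\gamma_I(G)+1$.
   Context: All graphs are finite, simple and undirected. $N(v)$ denotes the open neighborhood of a vertex $v$. An Italian dominating function (IDF) of a graph $G$ is a function $f:V(G)\to\{0,1,2\}$ such that every $v\in V(G)$ with $f(v)=0$ satisfies $\sum_{u\in N(v)}f(u)\ge 2$. Its weight is $\sum_{v\in V(G)}f(v)$, and the Italian domination number $\gamma_I(G)$ is the minimum weight of an IDF of $G$. -}

module Defs where

open import Data.Empty using (⊥)
open import Data.Fin using (Fin; zero; suc; toℕ; finToFun; funToFin)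
open import Data.Fin.Patterns using (0F; 2F)
open import Data.Fin.Properties using (all?; finToFun-funToFin) renaming (_≟_ to _≟ᶠ_)
open import Data.List using (List; map; filter; allFin; sum)
open import Data.List.Extrema.Nat using (argmin; argmin-all; f[argmin]≤v⁺)
open import Data.List.Membership.Propositional using (lose)
open import Data.List.Membership.Propositional.Properties using (∈-map⁺; ∈-filter⁺; ∈-allFin)
open import Data.List.Properties using (map-cong)
open import Data.List.Relation.Unary.All.Properties using (all-filter)
open import Data.Nat using (ℕ; suc; _^_; _≤_; _≤?_)
open import Data.Nat.Properties using (≤-reflexive)
open import Data.Product using (∃; _×_; _,_)
open import Data.Sum using (inj₂)
open import Function using (_∘_; const)
open import Relation.Binary using (Decidable; Symmetric; Irreflexive)
open import Relation.Binary.PropositionalEquality using (_≡_; _≗_; refl; sym; trans; cong; subst)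
open import Relation.Nullary using (Dec; no; _→-dec_)

record Graph (n : ℕ) : Set₁ where
  field
    Adj    : Fin n → Fin n → Set
    adj?   : Decidable Adj
    symm   : Symmetric Adj
    irrefl : Irreflexive _≡_ Adj

  N : Fin n → List (Fin n)
  N v = filter (adj? v) (allFin n)

open Graph public using (N)

Labelling : ℕ → Set
Labelling n = Fin n → Fin 3

sumOver : ∀ {n} → Labelling n → List (Fin n) → ℕ
sumOver f vs = sum (map (toℕ ∘ f) vs)

weight : ∀ {n} → Labelling n → ℕ
weight {n} f = sumOver f (allFin n)

IsIDF : ∀ {n} → Graph n → Labelling n → Set
IsIDF G f = ∀ v → f v ≡ 0F → 2 ≤ sumOver f (N G v)

isIDF? : ∀ {n} (G : Graph n) (f : Labelling n) → Dec (IsIDF G f)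
isIDF? G f = all? λ v → (f v ≟ᶠ 0F) →-dec (2 ≤? sumOver f (N G v))

allLabellings : ∀ n → List (Labelling n)
allLabellings n = map finToFun (allFin (3 ^ n))

-- The starting value const 2F of argmin is itself an IDF, so it does not
-- affect the minimum; see γI-attained and γI-minimal.
γI : ∀ {n} → Graph n → ℕ
γI {n} G = weight (argmin weight (const 2F) (filter (isIDF? G) (allLabellings n)))

γI-attained : ∀ {n} (G : Graph n) → ∃ λ f → IsIDF G f × weight f ≡ γI G
γI-attained {n} G =
  _ , argmin-all weight (λ _ ()) (all-filter (isIDF? G) (allLabellings n)) , refl

sumOver-cong : ∀ {n} {f g : Labelling n} → f ≗ g → ∀ vs → sumOver f vs ≡ sumOver g vs
sumOver-cong f≗g vs = cong sum (map-cong (cong toℕ ∘ f≗g) vs)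

IsIDF-resp-≗ : ∀ {n} (G : Graph n) {f g : Labelling n} → f ≗ g → IsIDF G f → IsIDF G g
IsIDF-resp-≗ G f≗g idf v gv≡0 =
  subst (2 ≤_) (sumOver-cong f≗g (N G v)) (idf v (trans (f≗g v) gv≡0))

γI-minimal : ∀ {n} (G : Graph n) (f : Labelling n) → IsIDF G f → γI G ≤ weight f
γI-minimal {n} G f idf = f[argmin]≤v⁺ {f = weight} (const 2F) (filter (isIDF? G) (allLabellings n))
  (inj₂ (lose
    (∈-filter⁺ (isIDF? G) (∈-map⁺ finToFun (∈-allFin (funToFin f)))
      (IsIDF-resp-≗ G (sym ∘ finToFun-funToFin f) idf))
    (≤-reflexive (sumOver-cong (finToFun-funToFin f) (allFin n)))))

module _ {n : ℕ} (G : Graph n) (u : Fin n) where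
  open Graph G

  -- The new vertex u' is zero; an old vertex v becomes suc v.
  TwinAdj : Fin (suc n) → Fin (suc n) → Set
  TwinAdj zero    zero    = ⊥
  TwinAdj zero    (suc w) = Adj u w
  TwinAdj (suc v) zero    = Adj v u
  TwinAdj (suc v) (suc w) = Adj v w

  attachFalseTwin : Graph (suc n)
  attachFalseTwin = record
    { Adj    = TwinAdj
    ; adj?   = twinAdj?
    ; symm   = λ {x} {y} → twinSymm x y
    ; irrefl = λ {x} → λ { refl → twinIrrefl x }
    }
    where
    twinAdj? : Decidable TwinAdj
    twinAdj? zero    zero    = no λ ()
    twinAdj? zero    (suc w) = adj? u w
    twinAdj? (suc v) zero    = adj? v u
    twinAdj? (suc v) (suc w) = adj? v w

    twinSymm : ∀ x y → TwinAdj x y → TwinAdj y x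
    twinSymm zero    (suc w) = symm
    twinSymm (suc v) zero    = symm
    twinSymm (suc v) (suc w) = symm

    twinIrrefl : ∀ x → TwinAdj x x → ⊥
    twinIrrefl (suc v) = irrefl refl

{-# OPTIONS --safe #-}
-- Upper bound: extend an optimal labelling f of G by f(u') = 0 if f(u) = 0, and by f(u') = 1
-- otherwise.  Lower bound: from an optimal labelling of the twin graph, move the label of u' onto
-- u, truncating the total at 2.  A neighbour v of u still sees weight at least 2, because either
-- nothing is lost or u itself now carries 2; the other vertices see the same labels as before.
module Submission where

open import Defs
open import Algebra.Properties.CommutativeSemigroup using (x∙yz≈y∙xz)
open import Data.Nat using (ℕ; suc; _+_; _≤_; z≤n; s≤s)
open import Data.Nat.Properties using (≤-refl; ≤-reflexive; ≤-trans; ≤-antisym; +-comm; +-assoc; +-mono-≤; +-monoˡ-≤; +-monoʳ-≤; m≤m+n; m≤n+m; m≤n⇒m<n∨m≡n; n≤0⇒n≡0; m<1+n⇒m≤n; +-commutativeSemigroup; module ≤-Reasoning)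
open import Data.Fin using (Fin; zero; suc; toℕ)
open import Data.Fin.Patterns using (0F; 1F; 2F)
open import Data.Fin.Properties using (_≟_; toℕ<n; toℕ-injective)
open import Data.List using (List; []; _∷_; map; filter; allFin; tabulate)
open import Data.Nat.ListAction using (sum)
open import Data.List.Membership.Propositional using (_∈_)
open import Data.List.Membership.Propositional.Properties using (∈-filter⁺; ∈-allFin)
open import Data.List.Properties using (map-∘; map-tabulate)
open import Data.List.Relation.Unary.Any using (here; there)
open import Data.Product using (∃; _×_; _,_)
open import Data.Sum using (_⊎_; inj₁; inj₂)
open import Data.Vec.Functional using (updateAt) renaming (_∷_ to _∷ᵛ_)
open import Data.Vec.Functional.Properties using (updateAt-updates; updateAt-minimal)
open import Function using (_∘_; id)
open import Relation.Binary.PropositionalEquality using (_≡_; refl; sym; trans; cong; subst)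
open import Relation.Nullary using (¬_; yes; no)
open import Level using (Level)
open import Relation.Unary using (Pred; Decidable)

private
  variable
    m n : ℕ
    ℓ : Level

sumOver-map : (g : Labelling n) (φ : Fin m → Fin n) (vs : List (Fin m)) →
              sumOver g (map φ vs) ≡ sumOver (g ∘ φ) vs
sumOver-map g φ vs = cong sum (sym (map-∘ vs))

sumOver-filter-map : {P : Pred (Fin n) ℓ} (P? : Decidable P) (g : Labelling n)
                     (φ : Fin m → Fin n) (vs : List (Fin m)) →
                     sumOver g (filter P? (map φ vs)) ≡ sumOver (g ∘ φ) (filter (P? ∘ φ) vs)
sumOver-filter-map P? g φ [] = refl
sumOver-filter-map P? g φ (v ∷ vs) with P? (φ v)
... | yes _ = cong (toℕ (g (φ v)) +_) (sumOver-filter-map P? g φ vs)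
... | no  _ = sumOver-filter-map P? g φ vs

-- `allFin (suc n)` unfolds to `zero ∷ tabulate suc`, so this compares the old vertices in a
-- neighborhood of the twin graph with a neighborhood in `G`.
sumOver-filter-suc : {P : Pred (Fin (suc n)) ℓ} (P? : Decidable P) (g : Labelling (suc n)) →
                     sumOver g (filter P? (tabulate suc)) ≡
                     sumOver (g ∘ suc) (filter (P? ∘ suc) (allFin n))
sumOver-filter-suc {n} P? g = trans
  (cong (sumOver g ∘ filter P?) (sym (map-tabulate id suc)))
  (sumOver-filter-map P? g suc (allFin n))

sumOver-mono : {f g : Labelling n} → (∀ v → toℕ (f v) ≤ toℕ (g v)) →
               ∀ vs → sumOver f vs ≤ sumOver g vs
sumOver-mono f≤g []       = z≤n
sumOver-mono f≤g (v ∷ vs) = +-mono-≤ (f≤g v) (sumOver-mono f≤g vs)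

∈⇒≤sumOver : (f : Labelling n) {v : Fin n} {vs : List (Fin n)} → v ∈ vs → toℕ (f v) ≤ sumOver f vs
∈⇒≤sumOver f (here refl)               = m≤m+n _ _
∈⇒≤sumOver f {vs = w ∷ _} (there v∈vs) = ≤-trans (∈⇒≤sumOver f v∈vs) (m≤n+m _ (toℕ (f w)))

-- One occurrence of `u` supplies the whole gain `k`; monotonicity covers all other entries. With
-- `k` the label of the twin, this makes up for the neighbor that is lost when the twin is removed.
sumOver-gain : {f g : Labelling n} {u : Fin n} (k : ℕ) → (∀ v → toℕ (f v) ≤ toℕ (g v)) →
               k + toℕ (f u) ≤ toℕ (g u) → {vs : List (Fin n)} → u ∈ vs →
               k + sumOver f vs ≤ sumOver g vs
sumOver-gain {f = f} {u = u} k f≤g gain {_ ∷ vs} (here refl) = ≤-trans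
  (≤-reflexive (sym (+-assoc k (toℕ (f u)) (sumOver f vs))))
  (+-mono-≤ gain (sumOver-mono f≤g vs))
sumOver-gain {f = f} k f≤g gain {w ∷ vs} (there u∈vs) = ≤-trans
  (≤-reflexive (x∙yz≈y∙xz +-commutativeSemigroup k (toℕ (f w)) (sumOver f vs)))
  (+-mono-≤ (f≤g w) (sumOver-gain k f≤g gain u∈vs))

weight-suc : (g : Labelling (suc n)) → weight g ≡ toℕ (g zero) + weight (g ∘ suc)
weight-suc {n} g = cong (toℕ (g zero) +_) (trans
  (cong (sumOver g) (sym (map-tabulate id suc)))
  (sumOver-map g suc (allFin n)))

-- Only one entry changes, so induction on its position peels off unchanged heads until it is
-- reached.
weight-updateAt-≤ : (h : Labelling n) (u : Fin n) (φ : Fin 3 → Fin 3) (k : ℕ) →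
                    toℕ (φ (h u)) ≤ k + toℕ (h u) → weight (updateAt h u φ) ≤ k + weight h
weight-updateAt-≤ h zero φ k φ≤ = begin
  weight (updateAt h zero φ)               ≡⟨ weight-suc (updateAt h zero φ) ⟩
  toℕ (φ (h zero)) + weight (h ∘ suc)      ≤⟨ +-monoˡ-≤ _ φ≤ ⟩
  k + toℕ (h zero) + weight (h ∘ suc)      ≡⟨ +-assoc k _ _ ⟩
  k + (toℕ (h zero) + weight (h ∘ suc))    ≡⟨ cong (k +_) (weight-suc h) ⟨
  k + weight h                             ∎
  where open ≤-Reasoning
weight-updateAt-≤ h (suc u) φ k φ≤ = begin
  weight (updateAt h (suc u) φ)                       ≡⟨ weight-suc (updateAt h (suc u) φ) ⟩
  toℕ (h zero) + weight (updateAt (h ∘ suc) u φ)      ≤⟨ +-monoʳ-≤ (toℕ (h zero)) (weight-updateAt-≤ (h ∘ suc) u φ k φ≤) ⟩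
  toℕ (h zero) + (k + weight (h ∘ suc))               ≡⟨ x∙yz≈y∙xz +-commutativeSemigroup (toℕ (h zero)) k _ ⟩
  k + (toℕ (h zero) + weight (h ∘ suc))               ≡⟨ cong (k +_) (weight-suc h) ⟨
  k + weight h                                        ∎
  where open ≤-Reasoning

infixl 6 _⊕_

-- Addition truncated at 2: two nonzero labels always reach the cap.
_⊕_ : Fin 3 → Fin 3 → Fin 3
zero  ⊕ b     = b
suc a ⊕ zero  = suc a
suc a ⊕ suc b = 2F

⊕-≤ : ∀ a b → toℕ (a ⊕ b) ≤ toℕ a + toℕ b
⊕-≤ zero    b       = ≤-refl
⊕-≤ (suc a) zero    = m≤m+n _ _
-- The 2 on the left is split as 1 + 1, one unit for each nonzero label.
⊕-≤ (suc a) (suc b) = +-mono-≤ {1} (s≤s z≤n) (s≤s z≤n)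

≤-⊕ : ∀ a b → toℕ b ≤ toℕ (a ⊕ b)
≤-⊕ zero    b       = ≤-refl
≤-⊕ (suc a) zero    = z≤n
≤-⊕ (suc a) (suc b) = m<1+n⇒m≤n (toℕ<n (suc b))

-- Truncation can lose weight only if both labels are nonzero, and then the cap is attained.
⊕-saturated-or-exact : ∀ a b → a ⊕ b ≡ 2F ⊎ toℕ a + toℕ b ≡ toℕ (a ⊕ b)
⊕-saturated-or-exact zero    b       = inj₂ refl
⊕-saturated-or-exact (suc a) zero    = inj₂ (+-comm (toℕ (suc a)) 0)
⊕-saturated-or-exact (suc a) (suc b) = inj₁ refl

-- The label `k` for the twin of a vertex labelled `a`: its bound yields the `+ 1` of the theorem,
-- its implication keeps the twin dominated.
twinLabel : (a : Fin 3) → ∃ λ (k : Fin 3) → toℕ k ≤ 1 × (k ≡ 0F → a ≡ 0F)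
twinLabel zero    = 0F , z≤n , id
twinLabel (suc a) = 1F , ≤-refl , λ ()

module _ (G : Graph n) (u : Fin n) where
  open Graph G using (Adj; adj?)

  private
    H : Graph (suc n)
    H = attachFalseTwin G u

  sumOver-N-twin : (g : Labelling (suc n)) → sumOver g (N H zero) ≡ sumOver (g ∘ suc) (N G u)
  sumOver-N-twin g = sumOver-filter-suc (Graph.adj? H zero) g

  sumOver-N-adj : (g : Labelling (suc n)) {v : Fin n} → Adj v u →
                  sumOver g (N H (suc v)) ≡ toℕ (g zero) + sumOver (g ∘ suc) (N G v)
  -- Whether the filter keeps the head `zero` is decided by `adj? v u`, so this split lets the sum
  -- reduce.
  sumOver-N-adj g {v} v~u with adj? v u
  ... | yes _   = cong (toℕ (g zero) +_) (sumOver-filter-suc (Graph.adj? H (suc v)) g)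
  ... | no  v≁u with () ← v≁u v~u

  sumOver-N-nonadj : (g : Labelling (suc n)) {v : Fin n} → ¬ Adj v u →
                     sumOver g (N H (suc v)) ≡ sumOver (g ∘ suc) (N G v)
  sumOver-N-nonadj g {v} v≁u with adj? v u
  ... | yes v~u with () ← v≁u v~u
  ... | no  _   = sumOver-filter-suc (Graph.adj? H (suc v)) g

  sumOver-N-≤ : (g : Labelling (suc n)) (v : Fin n) →
                sumOver (g ∘ suc) (N G v) ≤ sumOver g (N H (suc v))
  sumOver-N-≤ g v with adj? v u
  ... | yes _ = ≤-trans (≤-reflexive (sym (sumOver-filter-suc (Graph.adj? H (suc v)) g)))
                        (m≤n+m _ (toℕ (g zero)))
  ... | no  _ = ≤-reflexive (sym (sumOver-filter-suc (Graph.adj? H (suc v)) g))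

  -- A twin labelled 0 sees exactly what `u`, also labelled 0, sees in `G`; an old vertex can only
  -- gain a neighbor.
  extend-IsIDF : {f : Labelling n} (k : Fin 3) → (k ≡ 0F → f u ≡ 0F) →
                 IsIDF G f → IsIDF H (k ∷ᵛ f)
  extend-IsIDF {f} k k≡0⇒fu≡0 idf zero k≡0 =
    subst (2 ≤_) (sym (sumOver-N-twin (k ∷ᵛ f))) (idf u (k≡0⇒fu≡0 k≡0))
  extend-IsIDF {f} k _ idf (suc v) fv≡0 = ≤-trans (idf v fv≡0) (sumOver-N-≤ (k ∷ᵛ f) v)

  merge : Labelling (suc n) → Labelling n
  merge g = updateAt (g ∘ suc) u (g zero ⊕_)

  merge-≥ : (g : Labelling (suc n)) (v : Fin n) → toℕ (g (suc v)) ≤ toℕ (merge g v)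
  merge-≥ g v with v ≟ u
  ... | yes refl = subst ((toℕ (g (suc v)) ≤_) ∘ toℕ) (sym (updateAt-updates v (g ∘ suc)))
                         (≤-⊕ (g zero) (g (suc v)))
  ... | no  v≢u  = ≤-reflexive (cong toℕ (sym (updateAt-minimal v u (g ∘ suc) v≢u)))

  -- Merging never lowers a label. This makes the domination condition of `g` available at every
  -- vertex where that of `merge g` must be checked.
  merge-zero : (g : Labelling (suc n)) (v : Fin n) → merge g v ≡ 0F → g (suc v) ≡ 0F
  merge-zero g v mv≡0 =
    toℕ-injective (n≤0⇒n≡0 (subst ((toℕ (g (suc v)) ≤_) ∘ toℕ) mv≡0 (merge-≥ g v)))

  merge-IsIDF : (g : Labelling (suc n)) → IsIDF H g → IsIDF G (merge g)
  merge-IsIDF g idf v mv≡0 with adj? v u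
  -- The vertex `u` itself falls under this case, being adjacent neither to itself nor to its twin.
  ... | no v≁u  = begin
    2                             ≤⟨ idf (suc v) (merge-zero g v mv≡0) ⟩
    sumOver g (N H (suc v))       ≡⟨ sumOver-N-nonadj g v≁u ⟩
    sumOver (g ∘ suc) (N G v)     ≤⟨ sumOver-mono (merge-≥ g) (N G v) ⟩
    sumOver (merge g) (N G v)     ∎
    where open ≤-Reasoning
  ... | yes v~u = bound (⊕-saturated-or-exact (g zero) (g (suc u)))
    where
    open ≤-Reasoning
    mu≡ : merge g u ≡ g zero ⊕ g (suc u)
    mu≡ = updateAt-updates u (g ∘ suc)
    u∈Nv : u ∈ N G v
    u∈Nv = ∈-filter⁺ (adj? v) (∈-allFin u) v~u
    bound : g zero ⊕ g (suc u) ≡ 2F ⊎ toℕ (g zero) + toℕ (g (suc u)) ≡ toℕ (g zero ⊕ g (suc u)) →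
            2 ≤ sumOver (merge g) (N G v)
    bound (inj₁ saturated) = begin
      2                           ≡⟨ cong toℕ (trans mu≡ saturated) ⟨
      toℕ (merge g u)             ≤⟨ ∈⇒≤sumOver (merge g) u∈Nv ⟩
      sumOver (merge g) (N G v)   ∎
    bound (inj₂ exact) = begin
      2                                          ≤⟨ idf (suc v) (merge-zero g v mv≡0) ⟩
      sumOver g (N H (suc v))                    ≡⟨ sumOver-N-adj g v~u ⟩
      -- By exactness the label of `u` has grown by the full label of the twin.
      toℕ (g zero) + sumOver (g ∘ suc) (N G v)   ≤⟨ sumOver-gain _ (merge-≥ g) (≤-reflexive (trans exact (cong toℕ (sym mu≡)))) u∈Nv ⟩
      sumOver (merge g) (N G v)                  ∎

  weight-merge-≤ : (g : Labelling (suc n)) → weight (merge g) ≤ weight g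
  weight-merge-≤ g = ≤-trans
    (weight-updateAt-≤ (g ∘ suc) u (g zero ⊕_) (toℕ (g zero)) (⊕-≤ (g zero) (g (suc u))))
    (≤-reflexive (sym (weight-suc g)))

  γI-≤-twin : γI G ≤ γI H
  γI-≤-twin with g , idf , wg≡γ ← γI-attained H = begin
    γI G               ≤⟨ γI-minimal G (merge g) (merge-IsIDF g idf) ⟩
    weight (merge g)   ≤⟨ weight-merge-≤ g ⟩
    weight g           ≡⟨ wg≡γ ⟩
    γI H               ∎
    where open ≤-Reasoning

  γI-twin-≤ : γI H ≤ suc (γI G)
  γI-twin-≤ with f , idf , wf≡γ ← γI-attained G
            with k , k≤1 , k≡0⇒fu≡0 ← twinLabel (f u) = begin
    γI H               ≤⟨ γI-minimal H (k ∷ᵛ f) (extend-IsIDF k k≡0⇒fu≡0 idf) ⟩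
    weight (k ∷ᵛ f)    ≡⟨ weight-suc (k ∷ᵛ f) ⟩
    toℕ k + weight f   ≤⟨ +-monoˡ-≤ (weight f) k≤1 ⟩
    suc (weight f)     ≡⟨ cong suc wf≡γ ⟩
    suc (γI G)         ∎
    where open ≤-Reasoning

theorem3p4 : ∀ (n : ℕ) (G : Graph n) (u : Fin n) → (γI (attachFalseTwin G u) ≡ γI G) ⊎ (γI (attachFalseTwin G u) ≡ γI G + 1)
theorem3p4 n G u with m≤n⇒m<n∨m≡n (γI-≤-twin G u)
-- The strict inequality unfolds to `suc (γI G) ≤ γI H` for the twin graph `H`, which meets the
-- upper bound.
... | inj₁ γG<γH = inj₂ (trans (≤-antisym (γI-twin-≤ G u) γG<γH) (+-comm 1 (γI G)))
... | inj₂ γG≡γH = inj₁ (sym γG≡γH)
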